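{- Let $n,k$ be positive integers with $4\le 2k\le n$. Let $\mathcal{A}=\mathcal{F}([2,b])\cup\mathcal{F}(\{1,b\})\subseteq\binom{[n]}{k}$ with $4\le b\le k+1$ be an MLCIF of rank $2$ having exactly two maximal generators, and let $X\subseteq[2,n]$ with $|X|=d$. Let $\mathcal{S}=\{A\in\binom{[n]}{k}:1\in A\}$ and $\mu_X(b)=|X\cap[b]|$. Then: (i) If $X\cap[2,b]\ne\emptyset$, then $$|\mathcal{A}(X)|=\binom{n-1}{k-1}-\binom{n-b}{k-1}+\binom{n-b}{k-b+1}-\binom{n-d-1}{k-1}+\binom{n-d-b+\mu_X(b)}{k-1}.$$ In particular, if $X\subseteq[2,b]$, then $|\mathcal{A}(X)|=|\mathcal{S}(X)|+\binom{n-b}{k-b+1}$; and if $X\cap[2,b]\subsetneq X$, then for sufficiently large $n$ we have $|\mathcal{A}(X)|<|\mathcal{S}(X)|$. (ii) If $X\cap[2,b]=\emptyset$, then $$|\mathcal{A}(X)|=\binom{n-1}{k-1}-\binom{n-b}{k-1}+\binom{n-b}{k-b+1}-\binom{n-d-1}{k-1}+\binom{n-d-b}{k-1}-\binom{n-d-b}{k-b+1}.$$ Consequently, $|\mathcal{A}(X)|\le|\mathcal{S}(X)|$.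
   Context: Notation: $[n]=\{1,\dots,n\}$, $[m,n]=\{m,m+1,\dots,n\}$; $\binom{[n]}{k}$ is the set of all $k$-element subsets of $[n]$, and $\binom{[n]}{\le k}$ the set of all subsets of size at most $k$. Sets are always listed in increasing order. For a family $\mathcal{B}\subseteq 2^{[n]}$ and $X\subseteq[n]$, $\mathcal{B}(X)=\{B\in\mathcal{B}: B\cap X\ne\emptyset\}$. Orders: for two sets of the same size, $A=\{a_1<\dots<a_r\}$ and $B=\{b_1<\dots<b_r\}$, write $A\le B$ if $a_i\le b_i$ for all $i$. For $A=\{a_1<\dots<a_r\}$, $B=\{b_1<\dots<b_s\}$ write $A\preceq B$ if $r\ge s$ and $a_i\le b_i$ for all $1\le i\le s$. Generated families: for a collection $\mathcal{G}$ of subsets of $[n]$ of size at most $k$, $\mathcal{F}(\mathcal{G})=\{S\in\binom{[n]}{k}: S\preceq G\text{ for some }G\in\mathcal{G}\}$; for a single set $G$, $\mathcal{F}(G)=\mathcal{F}(\{G\})$. Families: $\mathcal{A}\subseteq\binom{[n]}{k}$ is intersecting if $S\cap T\ne\emptyset$ for all $S,T\in\mathcal{A}$; left-compressed if $A\in\mathcal{A}$, $B\in\binom{[n]}{k}$, $B\le A$ imply $B\in\mathcal{A}$. An intersecting family $\mathcal{A}\subseteq\binom{[n]}{k}$ is maximal if no other $k$-subset of $[n]$ can be added to it while preserving the intersecting property. An MLCIF is a maximal left-compressed intersecting family. Strong intersection: subsets $A,B$ of $[n]$ (possibly equal) are strongly intersecting if $A'\cap B'\ne\emptyset$ for all $A',B'\subseteq[n]$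 with $A'\le A$, $B'\le B$; a family is strongly intersecting if every pair of its members (including a member paired with itself) is. With $\mathcal{G}_k=\{G\in\binom{[2k-1]}{\le k}: |G\cap[k+|G|-1]|=|G|\}$, a principal generating set (PGS) is a strongly intersecting family $\mathcal{G}$ of members of $\mathcal{G}_k$ not containing $1$. Meet: for sets $A^1,\dots,A^m$ with $A^j=\{a^j_1<\dots<a^j_{r_j}\}$ and $d'=\max_j r_j$, $A^1\wedge\dots\wedge A^m=\{a_1,\dots,a_{d'}\}$ with $a_i=\min_j a^j_i$, where $a^j_i=+\infty$ if $i>r_j$. For a PGS $\mathcal{G}=\{G^1,\dots,G^m\}$, $G^j=\{g^j_1<\dots<g^j_{r_j}\}$, put $G^j_{i_j}=\{1\}\cup[i_j+1,g^j_{i_j}]$ for $i_j\in[r_j]$, and let $\mathcal{H}(\mathcal{G})$ be the set of all $H\subseteq[n]$ with $H\le G^1_{i_1}\wedge\dots\wedge G^m_{i_m}$ for some $(i_1,\dots,i_m)\in[r_1]\times\dots\times[r_m]$. Generators: every MLCIF $\mathcal{A}\subseteq\binom{[n]}{k}$ can be written as $\mathcal{A}=\mathcal{F}(\mathcal{G})\cup\mathcal{F}(\mathcal{H}(\mathcal{G}))$ for a PGS $\mathcal{G}$; the generators of $\mathcal{A}$ are the members of $\mathcal{G}\cup\mathcal{H}(\mathcal{G})$. A generator $G$ is maximal if there is no generator $G'\ne G$ with $G\preceq G'$. The rank of $\mathcal{A}$ is the minimum size of a generator. -}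

module Defs where

open import Level using (0ℓ)
open import Data.Bool using (true; false)
open import Data.Nat using (ℕ; suc; _+_; _*_; _∸_; _⊓_; _≤_; _≥_; _≤?_; _≥?_; _≟_)
open import Data.Fin using (Fin; toℕ)
open import Data.Fin.Subset using (Subset; ∣_∣; _∩_; _∪_; _⊆_; Nonempty)
open import Data.Fin.Subset.Properties using (nonempty?)
open import Data.List using (List; []; _∷_; _++_; map; foldr; length; lookup; filter)
open import Data.List.Membership.Propositional using (_∈_; _∉_)
open import Data.List.Membership.DecPropositional _≟_ using (_∈?_)
open import Data.List.Relation.Binary.Pointwise using (Pointwise)
open import Data.List.Relation.Binary.Prefix.Heterogeneous using (Prefix)
open import Data.List.Relation.Binary.Prefix.Heterogeneous.Properties using (prefix?)
open import Data.List.Relation.Unary.All using (All; reduce)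
open import Data.List.Relation.Unary.Unique.Propositional using (Unique)
open import Data.Product using (_×_; ∃; _,_)
open import Data.Sum using (_⊎_)
open import Data.Vec using ([]; _∷_; tabulate)
open import Relation.Binary.PropositionalEquality using (_≡_; _≢_; refl)
open import Relation.Nullary using (¬_; Dec; does; _×-dec_)
open import Relation.Nullary.Decidable using (map′)
open import Relation.Unary using (Pred; Decidable; _≐_; ｛_｝) renaming (_∪_ to _∪ᶠ_)
open import Relation.Unary.Properties using () renaming (_∪?_ to _∪ᶠ?_) public

-- A subset of [n] = {1,…,n} is a Subset n whose index i : Fin n stands for
-- the number suc (toℕ i).  Families of subsets of [n] are predicates.

Family : ℕ → Set₁
Family n = Pred (Subset n) 0ℓ

-- The members, in increasing order, as numbers between 1 and n.
elements : ∀ {n} → Subset n → List ℕ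
elements []          = []
elements (true ∷ A)  = 1 ∷ map suc (elements A)
elements (false ∷ A) = map suc (elements A)

-- {x ∈ [n] : P x}
comprehension : ∀ {n} {P : Pred ℕ 0ℓ} → Decidable P → Subset n
comprehension P? = tabulate λ i → does (P? (suc (toℕ i)))

[_⋯_] : ∀ {n} → ℕ → ℕ → Subset n
[ l ⋯ u ] = comprehension λ x → (l ≤? x) ×-dec (x ≤? u)

single : ∀ {n} → ℕ → Subset n
single x = comprehension (_≟ x)

infix 4 _≤ˢ_ _≼_

_≤ˢ_ : ∀ {n} → Subset n → Subset n → Set
A ≤ˢ B = Pointwise _≤_ (elements A) (elements B)

-- Some initial segment of A, of the same size as B, is termwise ≤ B.
_≼_ : ∀ {n} → Subset n → Subset n → Set
A ≼ B = Prefix _≥_ (elements B) (elements A)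

_≼?_ : ∀ {n} (A B : Subset n) → Dec (A ≼ B)
A ≼? B = prefix? _≥?_ (elements B) (elements A)

-- 𝓕 k 𝒢 is F(𝒢), and 𝓕₁ k G is F(G).
𝓕 : ∀ {n} → ℕ → Family n → Family n
𝓕 k 𝒢 S = ∣ S ∣ ≡ k × ∃ λ G → 𝒢 G × S ≼ G

𝓕₁ : ∀ {n} → ℕ → Subset n → Family n
𝓕₁ k G = 𝓕 k ｛ G ｝

𝓕₁? : ∀ {n} k (G : Subset n) → Decidable (𝓕₁ k G)
𝓕₁? k G S = (∣ S ∣ ≟ k) ×-dec
  map′ (λ S≼G → G , refl , S≼G) (λ { (_ , refl , S≼G) → S≼G }) (S ≼? G)

-- The family S of all k-sets containing 1.
Star : ∀ {n} → ℕ → Family n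
Star k S = ∣ S ∣ ≡ k × 1 ∈ elements S

Star? : ∀ {n} k → Decidable (Star {n} k)
Star? k S = (∣ S ∣ ≟ k) ×-dec (1 ∈? elements S)

-- 𝓑 ⟨ X ⟩ is 𝓑(X).
_⟨_⟩ : ∀ {n} → Family n → Subset n → Family n
(𝓑 ⟨ X ⟩) B = 𝓑 B × Nonempty (B ∩ X)

_⟨_⟩? : ∀ {n} {𝓑 : Family n} → Decidable 𝓑 → ∀ X → Decidable (𝓑 ⟨ X ⟩)
(𝓑? ⟨ X ⟩?) B = 𝓑? B ×-dec nonempty? (B ∩ X)

subsets : ∀ n → List (Subset n)
subsets 0       = [] ∷ []
subsets (suc n) = map (true ∷_) (subsets n) ++ map (false ∷_) (subsets n)

card : ∀ {n} {𝓑 : Family n} → Decidable 𝓑 → ℕ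
card {n} 𝓑? = length (filter 𝓑? (subsets n))

Uniform : ∀ {n} → ℕ → Family n → Set
Uniform k 𝒜 = ∀ {S} → 𝒜 S → ∣ S ∣ ≡ k

Intersecting : ∀ {n} → Family n → Set
Intersecting 𝒜 = ∀ {S T} → 𝒜 S → 𝒜 T → Nonempty (S ∩ T)

LeftCompressed : ∀ {n} → ℕ → Family n → Set
LeftCompressed k 𝒜 = ∀ {A B} → 𝒜 A → ∣ B ∣ ≡ k → B ≤ˢ A → 𝒜 B

record MLCIF {n} (k : ℕ) (𝒜 : Family n) : Set where
  field
    uniform        : Uniform k 𝒜
    intersecting   : Intersecting 𝒜
    maximal        : ∀ {S} → ∣ S ∣ ≡ k → ¬ 𝒜 S → ¬ Intersecting (𝒜 ∪ᶠ ｛ S ｝)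
    leftCompressed : LeftCompressed k 𝒜

StronglyIntersect : ∀ {n} → Subset n → Subset n → Set
StronglyIntersect A B = ∀ {A′ B′} → A′ ≤ˢ A → B′ ≤ˢ B → Nonempty (A′ ∩ B′)

-- Membership in 𝒢_k, as a family of subsets of [n]; 2k-1 ≤ n is intended.
Admissible : ∀ {n} → ℕ → Family n
Admissible k G =
  G ⊆ [ 1 ⋯ 2 * k ∸ 1 ] × ∣ G ∣ ≤ k × ∣ G ∩ [ 1 ⋯ k + ∣ G ∣ ∸ 1 ] ∣ ≡ ∣ G ∣

-- The finite set {G¹,…,Gᵐ} is given by a list of its members without
-- repetition; a repeated member would change ℋ below.
record PGS {n} (k : ℕ) (𝒢 : List (Subset n)) : Set where
  field
    distinct             : Unique 𝒢
    stronglyIntersecting : ∀ {G G′} → G ∈ 𝒢 → G′ ∈ 𝒢 → StronglyIntersect G G′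
    admissible           : ∀ {G} → G ∈ 𝒢 → Admissible k G
    without1             : ∀ {G} → G ∈ 𝒢 → 1 ∉ elements G

-- Termwise minimum, where missing entries count as +∞.
minima : List ℕ → List ℕ → List ℕ
minima []       ys       = ys
minima xs       []       = xs
minima (x ∷ xs) (y ∷ ys) = x ⊓ y ∷ minima xs ys

-- The m-fold meet A¹ ∧ ⋯ ∧ Aᵐ.
meet : ∀ {n} → List (Subset n) → Subset n
meet As = comprehension (_∈? foldr minima [] (map elements As))

Index : ∀ {n} → Subset n → Set
Index G = Fin (length (elements G))

-- {1} ∪ [i+1, gᵢ]; the position i counted from 1 is suc (toℕ j).
cut : ∀ {n} (G : Subset n) → Index G → Subset n
cut G j = single 1 ∪ [ suc (suc (toℕ j)) ⋯ lookup (elements G) j ]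

-- An element of All Index 𝒢 is a tuple (i₁,…,iₘ).
ℋ : ∀ {n} → List (Subset n) → Family n
ℋ 𝒢 H = ∃ λ (is : All Index 𝒢) → H ≤ˢ meet (reduce (λ {G} → cut G) is)

Generator : ∀ {n} → List (Subset n) → Family n
Generator 𝒢 = (_∈ 𝒢) ∪ᶠ ℋ 𝒢

Generates : ∀ {n} → ℕ → List (Subset n) → Family n → Set
Generates k 𝒢 𝒜 = 𝒜 ≐ (𝓕 k (_∈ 𝒢) ∪ᶠ 𝓕 k (ℋ 𝒢))

MaximalGenerator : ∀ {n} → List (Subset n) → Family n
MaximalGenerator 𝒢 G =
  Generator 𝒢 G × ¬ ∃ λ G′ → Generator 𝒢 G′ × G′ ≢ G × G ≼ G′

HasRank : ∀ {n} → List (Subset n) → ℕ → Set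
HasRank 𝒢 r =
  (∃ λ G → Generator 𝒢 G × ∣ G ∣ ≡ r) × (∀ {G} → Generator 𝒢 G → r ≤ ∣ G ∣)

ExactlyTwo : ∀ {n} → Family n → Set
ExactlyTwo 𝓑 =
  ∃ λ A → ∃ λ B → A ≢ B × 𝓑 A × 𝓑 B × (∀ {C} → 𝓑 C → C ≡ A ⊎ C ≡ B)

{-# OPTIONS --safe #-}
module Submission where

-- A k-set S lies in 𝒜 iff either 1 ∈ S and S meets [2,b], or 1 ∉ S and
-- [2,b] ⊆ S.  The members meeting X of the first kind are counted by
-- inclusion-exclusion, those of the second kind by choosing the k+1-b elements
-- of S beyond b.  For (ii), C(m,k-1) - C(m,k+1-b) is at most 0 up to m = 2k-b
-- and nondecreasing from there on, and n-b ≥ 2k-b.  For the strict inequality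
-- in (i), if n ≥ 4k then
-- C(n-b,k+1-b) ≤ C(n-b,k-3) < C(n-b-1,k-2) = C(n-b,k-1) - C(n-b-1,k-1).

open import Defs
open import Data.Bool using (true; false)
open import Data.Fin using (zero; suc; toℕ)
open import Data.Fin.Subset
  using (Subset; ∣_∣; _∩_; _∪_; ∁; ⊥; ⊤; _⊆_; _⊂_; Nonempty; Empty)
  renaming (_∈_ to _∈ˢ_)
open import Data.Fin.Subset.Properties
  using ( _⊆?_; nonempty?; drop-∷-⊆; drop-∷-Empty; Empty-unique; s⊆s; out⊆; ⊥⊆; ⊆⊤; ∉⊥
        ; ⊆-trans; ⊆-antisym; p⊆q⇒∁p⊇∁q; p⊆p∪q; q⊆p∪q; x∈p∩q⁺; x∈p∩q⁻; x∈p∪q⁻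
        ; x∈∁p⇒x∉p; x∉p⇒x∈∁p; p⊆q⇒∣p∣≤∣q∣; p⊂q⇒∣p∣<∣q∣; ∣p∣≤n; ∣∁p∣≡n∸∣p∣; ∣⊥∣≡0; ∣⊤∣≡n
        ; ∪-identityˡ; ∩-comm )
open import Data.Integer using (+_) renaming (_+_ to _⊕_; _-_ to _⊖_)
import Data.Integer.Tactic.RingSolver as ℤSolver
open import Data.List as List using (List; []; _∷_; _++_; length; filter)
open import Data.List.Membership.Propositional using (_∉_)
open import Data.List.Membership.Propositional.Properties using (∈-map⁻)
open import Data.List.Properties using (filter-≐; filter-++; length-++)
open import Data.List.Relation.Binary.Prefix.Heterogeneous as Prefix using (Prefix; []; _∷_)
open import Data.List.Relation.Binary.Prefix.Heterogeneous.Properties using (map⁺; map⁻)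
import Data.List.Relation.Unary.Any as Any
open import Data.Nat
open import Data.Nat.Combinatorics
  using (_C_; nCk≡nC[n∸k]; nCn≡1; nC1≡n; k>n⇒nCk≡0; nCk+nC[k+1]≡[n+1]C[k+1])
open import Data.Nat.Properties
open import Data.Nat.Tactic.RingSolver using (solve-∀)
open import Data.Product using (_×_; _,_; ∃; proj₁; proj₂)
open import Data.Sum using (inj₁; inj₂; [_,_]′)
open import Data.Vec using ([]; _∷_; tabulate; here; there)
open import Function using (_∘_; _⇔_; mk⇔; Equivalence)
open import Relation.Binary.PropositionalEquality
open import Relation.Nullary using (¬_; yes; no; does; contradiction; _×-dec_)
open import Relation.Unary using (Decidable; _≐_) renaming (_∩_ to _∩ᶠ_; _∪_ to _∪ᶠ_)
open import Relation.Unary.Properties using (_∩?_; ∁?)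

-- Binomial coefficients

C-zero : ∀ n → n C 0 ≡ 1
C-zero n = trans (nCk≡nC[n∸k] {0} {n} z≤n) (nCn≡1 n)

pascal : ∀ n k → suc n C suc k ≡ n C k + n C suc k
pascal n k = sym (nCk+nC[k+1]≡[n+1]C[k+1] n k)

C-symmetric : ∀ i j → (i + j) C i ≡ (i + j) C j
C-symmetric i j = trans (nCk≡nC[n∸k] (m≤m+n i j)) (cong ((i + j) C_) (m+n∸m≡n i j))

C-positive : ∀ {n k} → k ≤ n → 0 < n C k
C-positive {n} {zero} _ = ≤-reflexive (sym (C-zero n))
C-positive {suc n} {suc k} (s≤s k≤n) =
  ≤-trans (C-positive k≤n) (≤-trans (m≤m+n _ _) (≤-reflexive (sym (pascal n k))))

C-step : ∀ n k → n C k ≤ suc n C k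
C-step n zero    = ≤-reflexive (trans (C-zero n) (sym (C-zero (suc n))))
C-step n (suc k) = ≤-trans (m≤n+m _ _) (≤-reflexive (sym (pascal n k)))

C-monoˡ : ∀ {m n} k → m ≤ n → m C k ≤ n C k
C-monoˡ {m} k m≤n with d , refl ← m≤n⇒∃[o]m+o≡n m≤n = go d
  where
  go : ∀ d → m C k ≤ (m + d) C k
  go zero    = ≤-reflexive (cong (_C k) (sym (+-identityʳ m)))
  go (suc d) = ≤-trans (go d) (≤-trans (C-step (m + d) k)
    (≤-reflexive (cong (_C k) (sym (+-suc m d)))))

-- Pascal's rule splits both sides, and below the boundary the terms compare pairwise by induction.
C-unimodal : ∀ {n i j} → i ≤ j → i + j ≤ n → n C i ≤ n C j
C-unimodal {n} {zero} {j} _ j≤n = ≤-trans (≤-reflexive (C-zero n)) (C-positive j≤n)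
C-unimodal {suc n} {suc i} {suc j} (s≤s i≤j) (s≤s i+1+j≤n) = begin
  suc n C suc i       ≡⟨ pascal n i ⟩
  n C i + n C suc i   ≤⟨ sum ⟩
  n C j + n C suc j   ≡⟨ pascal n j ⟨
  suc n C suc j       ∎
  where
  open ≤-Reasoning
  sum : n C i + n C suc i ≤ n C j + n C suc j
  sum with m≤n⇒m<n∨m≡n i+1+j≤n
  ... | inj₁ i+1+j<n = +-mono-≤
    (C-unimodal i≤j (≤-trans (+-monoʳ-≤ i (n≤1+n j)) i+1+j≤n))
    (C-unimodal (s≤s i≤j) i+1+j<n)
  -- On the boundary n = i + (j + 1), the reflection x to n - x carries each term of one sum to a
  -- term of the other, so the sums are equal.
  ... | inj₂ refl = ≤-reflexive (trans (+-comm ((i + suc j) C i) _)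
    (cong₂ _+_ (subst (λ n → n C suc i ≡ n C j) (sym (+-suc i j)) (C-symmetric (suc i) j))
               (C-symmetric i (suc j))))

-- Reflecting j to n - j, which is at most i, reduces this to `C-unimodal`; for j > n the left side
-- is 0.
C-antimodal : ∀ {n i j} → i ≤ j → n ≤ i + j → n C j ≤ n C i
C-antimodal {n} {i} {j} i≤j n≤i+j with j ≤? n
... | no j≰n = ≤-trans (≤-reflexive (k>n⇒nCk≡0 (≰⇒> j≰n))) z≤n
... | yes j≤n = ≤-trans (≤-reflexive (nCk≡nC[n∸k] j≤n)) (C-unimodal {n} {n ∸ j} {i}
  (m≤n+o⇒m∸n≤o n j (≤-trans n≤i+j (≤-reflexive (+-comm i j))))
  (≤-trans (+-monoʳ-≤ (n ∸ j) i≤j) (≤-reflexive (m∸n+n≡m j≤n))))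

-- This compares the difference C(x,j) - C(x,i) at x = m and x = n, written with sums to avoid
-- truncated subtraction. For m at most i + j the difference is nonpositive at m and nonnegative at
-- n; otherwise it grows at each step from m to n.
C-difference-mono : ∀ {m n i j} → i ≤ j → i + j ≤ n → m ≤ n →
                    m C j + n C i ≤ n C j + m C i
C-difference-mono {m} {n} {i} {j} i≤j i+j≤n m≤n with ≤-total m (i + j)
... | inj₁ m≤i+j = ≤-trans (+-mono-≤ (C-antimodal i≤j m≤i+j) (C-unimodal i≤j i+j≤n))
                           (≤-reflexive (+-comm (m C i) _))
... | inj₂ i+j≤m with d , refl ← m≤n⇒∃[o]m+o≡n m≤n = go d
  where
  open ≤-Reasoning
  -- By Pascal's rule the increment of the difference is C(n,j-1) - C(n,i-1), which is nonnegative
  -- by unimodality.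
  step : ∀ {n i j} → i ≤ j → i + j ≤ n → n C j + suc n C i ≤ suc n C j + n C i
  step {n} {zero} {zero} _ _ = ≤-reflexive (+-comm (n C 0) _)
  step {n} {zero} {suc j} _ _ rewrite C-zero n | C-zero (suc n) =
    +-monoˡ-≤ 1 (C-step n (suc j))
  step {n} {suc i} {suc j} (s≤s i≤j) 2+i+j≤n = begin
    n C suc j + suc n C suc i       ≡⟨ cong (λ x → n C suc j + x) (pascal n i) ⟩
    n C suc j + (n C i + n C suc i) ≤⟨ +-monoʳ-≤ (n C suc j) (+-monoˡ-≤ _ (C-unimodal i≤j
      (≤-trans (≤-trans (+-monoʳ-≤ i (n≤1+n j)) (n≤1+n _)) 2+i+j≤n))) ⟩
    n C suc j + (n C j + n C suc i) ≡⟨ x+[y+z]≡[y+x]+z (n C suc j) (n C j) (n C suc i) ⟩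
    n C j + n C suc j + n C suc i   ≡⟨ cong (_+ n C suc i) (pascal n j) ⟨
    suc n C suc j + n C suc i       ∎
    where
    x+[y+z]≡[y+x]+z : ∀ x y z → x + (y + z) ≡ y + x + z
    x+[y+z]≡[y+x]+z = solve-∀
  go : ∀ d → m C j + (m + d) C i ≤ (m + d) C j + m C i
  go zero rewrite +-identityʳ m = ≤-refl
  -- The values at m + d are added to both sides so that the induction hypothesis and one increment
  -- can be summed.
  go (suc d) rewrite +-suc m d = +-cancelʳ-≤ ((m + d) C j + (m + d) C i) _ _ (begin
    m C j + suc (m + d) C i + ((m + d) C j + (m + d) C i)
      ≡⟨ swap (m C j) (suc (m + d) C i) ((m + d) C j) ((m + d) C i) ⟩
    m C j + (m + d) C i + ((m + d) C j + suc (m + d) C i)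
      ≤⟨ +-mono-≤ (go d) (step i≤j (≤-trans i+j≤m (m≤m+n m d))) ⟩
    (m + d) C j + m C i + (suc (m + d) C j + (m + d) C i)
      ≡⟨ swap′ ((m + d) C j) (m C i) (suc (m + d) C j) ((m + d) C i) ⟩
    suc (m + d) C j + m C i + ((m + d) C j + (m + d) C i) ∎)
    where
    swap : ∀ w x y z → w + x + (y + z) ≡ w + z + (y + x)
    swap = solve-∀
    swap′ : ∀ w x y z → w + x + (y + z) ≡ y + x + (w + z)
    swap′ = solve-∀

-- Induction by Pascal's rule: splitting off one copy of `p` leaves exactly the coefficients of the
-- two induction hypotheses.
C-absorption : ∀ n k → suc k * (suc n C suc k) ≡ suc n * (n C k)
C-absorption n zero = begin
  1 * (suc n C 1) ≡⟨ *-identityˡ _ ⟩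
  suc n C 1       ≡⟨ nC1≡n (suc n) ⟩
  suc n           ≡⟨ *-identityʳ (suc n) ⟨
  suc n * 1       ≡⟨ cong (suc n *_) (C-zero n) ⟨
  suc n * (n C 0) ∎
  where open ≡-Reasoning
C-absorption zero (suc k) = *-zeroʳ (suc (suc k))
C-absorption (suc n) (suc k) = begin
  suc (suc k) * (suc (suc n) C suc (suc k))
    ≡⟨ cong (suc (suc k) *_) (pascal (suc n) (suc k)) ⟩
  suc (suc k) * (p + suc n C suc (suc k))
    ≡⟨ split k p (suc n C suc (suc k)) ⟩
  p + (suc k * p + suc (suc k) * (suc n C suc (suc k)))
    ≡⟨ cong (λ x → p + x) (cong₂ _+_ (C-absorption n k) (C-absorption n (suc k))) ⟩
  p + (suc n * (n C k) + suc n * (n C suc k))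
    ≡⟨ cong (λ x → p + x) (*-distribˡ-+ (suc n) (n C k) _) ⟨
  p + suc n * (n C k + n C suc k)
    ≡⟨ cong (λ x → p + suc n * x) (pascal n k) ⟨
  suc (suc n) * p ∎
  where
  open ≡-Reasoning
  p = suc n C suc k
  split : ∀ k x y → suc (suc k) * (x + y) ≡ x + (suc k * x + suc (suc k) * y)
  split = solve-∀

C-double : ∀ {n} k → k + k ≤ n → suc n C k ≤ 2 * (n C k)
C-double {n} zero _ rewrite C-zero (suc n) | C-zero n = s≤s z≤n
C-double {n} (suc k) 2k+2≤n = begin
  suc n C suc k           ≡⟨ pascal n k ⟩
  n C k + n C suc k       ≤⟨ +-monoˡ-≤ _ (C-unimodal (n≤1+n k) (<⇒≤ 2k+2≤n)) ⟩
  n C suc k + n C suc k   ≡⟨ cong (λ x → n C suc k + x) (+-identityʳ _) ⟨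
  2 * (n C suc k)         ∎
  where open ≤-Reasoning

-- The left side is at most 2 C(n,k) by `C-double`. Since (k+1) C(n,k+1) = (n-k) C(n,k) and n - k >
-- 2(k+1), this is below C(n,k+1). The term (k+1) C(n,k) is added throughout to avoid the
-- subtraction n - k.
C-growth : ∀ {n k} → 3 * suc k ≤ n → suc n C k < n C suc k
C-growth {n} {k} 3k+3≤n with r , refl ← m≤n⇒∃[o]m+o≡n 3k+3≤n =
  ≤-<-trans (C-double k (≤-trans (m+n≤o⇒m≤o (k + k) (≤-reflexive (excess k))) 3k+3≤n))
  (*-cancelˡ-< (suc k) _ _ (+-cancelʳ-< (suc k * (n C k)) _ _ (begin-strict
    suc k * (2 * (n C k)) + suc k * (n C k)
      -- With n = 3(k+1) + r, the factor n + 1 exceeds 3(k+1) by r + 1 > 0.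
      <⟨ m<m+n _ (≤-trans (C-positive k≤n) (m≤n*m _ (suc r))) ⟩
    suc k * (2 * (n C k)) + suc k * (n C k) + suc r * (n C k) ≡⟨ collect k r (n C k) ⟩
    suc n * (n C k)                         ≡⟨ C-absorption n k ⟨
    suc k * (suc n C suc k)                 ≡⟨ cong (suc k *_) (pascal n k) ⟩
    suc k * (n C k + n C suc k)             ≡⟨ *-distribˡ-+ (suc k) (n C k) _ ⟩
    suc k * (n C k) + suc k * (n C suc k)   ≡⟨ +-comm (suc k * (n C k)) _ ⟩
    suc k * (n C suc k) + suc k * (n C k)   ∎)))
  where
  open ≤-Reasoning
  k≤n : k ≤ n
  k≤n = ≤-trans (≤-trans (n≤1+n k) (m≤n*m (suc k) 3)) 3k+3≤n
  collect : ∀ k r x → suc k * (2 * x) + suc k * x + suc r * x ≡ suc (3 * suc k + r) * x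
  collect = solve-∀
  excess : ∀ k → k + k + (3 + k) ≡ 3 * suc k
  excess = solve-∀

-- In the application e = k - 3, M = n - b and j = k + 1 - b, so j ≤ e says b ≥ 4. Lowering M by one
-- already frees C(M-1,e+1), which beats C(M,e) by `C-growth`.
C-growth-gap : ∀ {M w j e} → j ≤ e → 3 * suc e < M → w < M → M C j + w C (2 + e) < M C (2 + e)
C-growth-gap {suc M} {w} {j} {e} j≤e (s≤s 3e+3≤M) (s≤s w≤M) = begin-strict
  suc M C j + w C (2 + e)       ≤⟨ +-mono-≤ (C-unimodal j≤e j+e≤1+M) (C-monoˡ (2 + e) w≤M) ⟩
  suc M C e + M C (2 + e)       <⟨ +-monoˡ-< (M C (2 + e)) (C-growth 3e+3≤M) ⟩
  M C (1 + e) + M C (2 + e)     ≡⟨ pascal M (1 + e) ⟨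
  suc M C (2 + e)               ∎
  where
  open ≤-Reasoning
  excess : ∀ e → e + e + (3 + e) ≡ 3 * suc e
  excess = solve-∀
  j+e≤1+M : j + e ≤ suc M
  j+e≤1+M = ≤-trans (+-monoˡ-≤ e j≤e) (m≤n⇒m≤1+n
    (≤-trans (m+n≤o⇒m≤o (e + e) (≤-reflexive (excess e))) 3e+3≤M))

C-growth-gap-∸ : ∀ {N m κ j w} → 3 ≤ m → m + j ≡ suc κ → 4 * suc κ ≤ suc N → w < N ∸ m →
                 (N ∸ m) C j + w C κ < (N ∸ m) C κ
C-growth-gap-∸ {N} {suc (suc (suc m))} {j = j} (s≤s (s≤s (s≤s _))) refl 4k≤n w<M =
  C-growth-gap (m≤n+m j m)
    (m+n≤o⇒m≤o∸n _ (s≤s⁻¹ (≤-trans (m+n≤o⇒m≤o _ (≤-reflexive (excess m j))) 4k≤n))) w<M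
  where
  -- With the pattern variable `m` now the old one minus 3, k = 3 + m + j; the bound n ≥ 4k has
  -- slack 4 + j over what `C-growth-gap` asks.
  excess : ∀ m j → suc (suc (3 * suc (m + j)) + (3 + m)) + (4 + j) ≡ 4 * (3 + (m + j))
  excess = solve-∀

-- Counting families of subsets

module _ {n : ℕ} {𝓑 𝓒 : Family n} (𝓑? : Decidable 𝓑) (𝓒? : Decidable 𝓒) where

  card-≐ : 𝓑 ≐ 𝓒 → card 𝓑? ≡ card 𝓒?
  card-≐ 𝓑≐𝓒 = cong length (filter-≐ 𝓑? 𝓒? 𝓑≐𝓒 (subsets n))

  card-split : card 𝓑? ≡ card (𝓑? ∩? 𝓒?) + card (𝓑? ∩? ∁? 𝓒?)
  card-split = go (subsets n)
    where
    go : ∀ Ss → length (filter 𝓑? Ss) ≡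
                length (filter (𝓑? ∩? 𝓒?) Ss) + length (filter (𝓑? ∩? ∁? 𝓒?) Ss)
    go [] = refl
    go (S ∷ Ss) with 𝓑? S | 𝓒? S
    ... | no _  | _     = go Ss
    ... | yes _ | yes _ = cong suc (go Ss)
    ... | yes _ | no _  = trans (cong suc (go Ss)) (sym (+-suc _ _))

card-∩-swap : ∀ {n} {𝓑 𝓒 𝓓 : Family n}
              (𝓑? : Decidable 𝓑) (𝓒? : Decidable 𝓒) (𝓓? : Decidable 𝓓) →
              card ((𝓑? ∩? 𝓒?) ∩? 𝓓?) ≡ card ((𝓑? ∩? 𝓓?) ∩? 𝓒?)
card-∩-swap 𝓑? 𝓒? 𝓓? = card-≐ ((𝓑? ∩? 𝓒?) ∩? 𝓓?) ((𝓑? ∩? 𝓓?) ∩? 𝓒?)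
  ((λ ((b , c) , d) → (b , d) , c) , (λ ((b , d) , c) → (b , c) , d))

card-∅ : ∀ {n} {𝓑 : Family n} (𝓑? : Decidable 𝓑) → (∀ {S} → ¬ 𝓑 S) → card 𝓑? ≡ 0
card-∅ {n} 𝓑? ¬𝓑 = go (subsets n)
  where
  go : ∀ Ss → length (filter 𝓑? Ss) ≡ 0
  go [] = refl
  go (S ∷ Ss) with 𝓑? S
  ... | yes 𝓑S = contradiction 𝓑S ¬𝓑
  ... | no _   = go Ss

card-suc : ∀ {n} {𝓑 : Family (suc n)} (𝓑? : Decidable 𝓑) →
           card 𝓑? ≡ card (𝓑? ∘ (true ∷_)) + card (𝓑? ∘ (false ∷_))
card-suc {n} 𝓑? = begin
  length (filter 𝓑? (List.map (true ∷_) Ss ++ List.map (false ∷_) Ss))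
    ≡⟨ cong length (filter-++ 𝓑? (List.map (true ∷_) Ss) _) ⟩
  length (filter 𝓑? (List.map (true ∷_) Ss) ++ filter 𝓑? (List.map (false ∷_) Ss))
    ≡⟨ length-++ (filter 𝓑? (List.map (true ∷_) Ss)) ⟩
  length (filter 𝓑? (List.map (true ∷_) Ss)) + length (filter 𝓑? (List.map (false ∷_) Ss))
    ≡⟨ cong₂ _+_ (along true Ss) (along false Ss) ⟩
  card (𝓑? ∘ (true ∷_)) + card (𝓑? ∘ (false ∷_)) ∎
  where
  open ≡-Reasoning
  Ss = subsets n
  along : ∀ s Ss → length (filter 𝓑? (List.map (s ∷_) Ss)) ≡ length (filter (𝓑? ∘ (s ∷_)) Ss)
  along s [] = refl
  along s (S ∷ Ss) with does (𝓑? (s ∷ S))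
  ... | true  = cong suc (along s Ss)
  ... | false = along s Ss

Layer : ∀ {n} → ℕ → Family n
Layer k S = ∣ S ∣ ≡ k

Layer? : ∀ {n} k → Decidable (Layer {n} k)
Layer? k S = ∣ S ∣ ≟ k

Interval : ∀ {n} → ℕ → Subset n → Subset n → Family n
Interval k P R S = ∣ S ∣ ≡ k × P ⊆ S × S ⊆ R

Interval? : ∀ {n} k (P R : Subset n) → Decidable (Interval k P R)
Interval? k P R S = (∣ S ∣ ≟ k) ×-dec ((P ⊆? S) ×-dec (S ⊆? R))

-- Such a set is `P` plus a free choice of j elements of `R` outside `P`. Only positions in `R` but
-- not in `P` branch, and there the two branches add up by Pascal's rule.
card-Interval : ∀ {n} (P R : Subset n) j → P ⊆ R →
                card (Interval? (∣ P ∣ + j) P R) ≡ (∣ R ∣ ∸ ∣ P ∣) C j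
card-Interval [] [] zero _ = refl
card-Interval [] [] (suc j) _ = refl
card-Interval (p ∷ P) (r ∷ R) j pP⊆rR =
  trans (card-suc (Interval? _ (p ∷ P) (r ∷ R))) (split p r j pP⊆rR)
  where
  P⊆R : P ⊆ R
  P⊆R = drop-∷-⊆ pP⊆rR
  slice : ∀ p r k s → Decidable (Interval k (p ∷ P) (r ∷ R) ∘ (s ∷_))
  slice p r k s = Interval? k (p ∷ P) (r ∷ R) ∘ (s ∷_)
  split : ∀ p r j → (p ∷ P) ⊆ (r ∷ R) →
          card (slice p r (∣ p ∷ P ∣ + j) true) + card (slice p r (∣ p ∷ P ∣ + j) false) ≡
          (∣ r ∷ R ∣ ∸ ∣ p ∷ P ∣) C j
  split true false j tP⊆fR with () ← tP⊆fR here
  split true true j _ = trans (cong₂ _+_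
    (trans (card-≐ (slice true true _ true) (Interval? (∣ P ∣ + j) P R)
      ( (λ (c , lo , hi) → suc-injective c , drop-∷-⊆ lo , drop-∷-⊆ hi)
      , (λ (c , lo , hi) → cong suc c , s⊆s lo , s⊆s hi)))
      (card-Interval P R j P⊆R))
    (card-∅ (slice true true _ false) λ (_ , lo , _) → contradiction (lo here) λ ()))
    (+-identityʳ _)
  split false false j _ = cong₂ _+_
    (card-∅ (slice false false _ true) λ (_ , _ , hi) → contradiction (hi here) λ ())
    (trans (card-≐ (slice false false _ false) (Interval? (∣ P ∣ + j) P R)
      ( (λ (c , lo , hi) → c , drop-∷-⊆ lo , drop-∷-⊆ hi)
      , (λ (c , lo , hi) → c , s⊆s lo , s⊆s hi)))
      (card-Interval P R j P⊆R))
  -- With j = 0 the set must be `P` itself, so the branch that takes the free element is empty.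
  split false true zero _ = begin
    _ ≡⟨ cong₂ _+_
      (card-∅ (slice false true _ true) λ (c , lo , _) →
        <⇒≱ (≤-reflexive (trans c (+-identityʳ _))) (p⊆q⇒∣p∣≤∣q∣ (drop-∷-⊆ lo)))
      (trans (card-≐ (slice false true _ false) (Interval? (∣ P ∣ + 0) P R)
        ( (λ (c , lo , hi) → c , drop-∷-⊆ lo , drop-∷-⊆ hi)
        , (λ (c , lo , hi) → c , s⊆s lo , out⊆ hi)))
        (card-Interval P R 0 P⊆R)) ⟩
    (∣ R ∣ ∸ ∣ P ∣) C 0     ≡⟨ C-zero (∣ R ∣ ∸ ∣ P ∣) ⟩
    1                       ≡⟨ C-zero (suc ∣ R ∣ ∸ ∣ P ∣) ⟨
    (suc ∣ R ∣ ∸ ∣ P ∣) C 0 ∎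
    where open ≡-Reasoning
  split false true (suc j) _ = begin
    _ ≡⟨ cong₂ _+_
      (trans (card-≐ (slice false true _ true) (Interval? (∣ P ∣ + j) P R)
        ( (λ (c , lo , hi) → suc-injective (trans c (+-suc _ j)) , drop-∷-⊆ lo , drop-∷-⊆ hi)
        , (λ (c , lo , hi) → trans (cong suc c) (sym (+-suc _ j)) , out⊆ lo , s⊆s hi)))
        (card-Interval P R j P⊆R))
      (trans (card-≐ (slice false true _ false) (Interval? (∣ P ∣ + suc j) P R)
        ( (λ (c , lo , hi) → c , drop-∷-⊆ lo , drop-∷-⊆ hi)
        , (λ (c , lo , hi) → c , s⊆s lo , out⊆ hi)))
        (card-Interval P R (suc j) P⊆R)) ⟩
    (∣ R ∣ ∸ ∣ P ∣) C j + (∣ R ∣ ∸ ∣ P ∣) C suc j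
      ≡⟨ pascal (∣ R ∣ ∸ ∣ P ∣) j ⟨
    suc (∣ R ∣ ∸ ∣ P ∣) C suc j
      ≡⟨ cong (_C suc j) (+-∸-assoc 1 (p⊆q⇒∣p∣≤∣q∣ P⊆R)) ⟨
    (suc ∣ R ∣ ∸ ∣ P ∣) C suc j ∎
    where open ≡-Reasoning

-- Uniform families that meet or avoid given sets

Empty-∩⇒⊆∁ : ∀ {n} {S Y : Subset n} → Empty (S ∩ Y) → S ⊆ ∁ Y
Empty-∩⇒⊆∁ S∩Y=∅ x∈S = x∉p⇒x∈∁p λ x∈Y → S∩Y=∅ (_ , x∈p∩q⁺ (x∈S , x∈Y))

⊆∁⇒Empty-∩ : ∀ {n} {S Y : Subset n} → S ⊆ ∁ Y → Empty (S ∩ Y)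
⊆∁⇒Empty-∩ {S = S} {Y} S⊆∁Y (x , x∈S∩Y) with x∈S , x∈Y ← x∈p∩q⁻ S Y x∈S∩Y =
  x∈∁p⇒x∉p (S⊆∁Y x∈S) x∈Y

Meets : ∀ {n} → Subset n → Family n
Meets Y S = Nonempty (S ∩ Y)

Meets? : ∀ {n} (Y : Subset n) → Decidable (Meets Y)
Meets? Y S = nonempty? (S ∩ Y)

module _ {n : ℕ} (k : ℕ) where

  -- These sets form the interval from the empty set to the complement of `Y`. The family is
  -- arbitrary up to `≐` because `card` depends on the decision procedure.
  card-Layer-avoiding : ∀ {𝓑 : Family n} (𝓑? : Decidable 𝓑) (Y : Subset n) →
                        𝓑 ≐ (λ S → ∣ S ∣ ≡ k × S ⊆ ∁ Y) → card 𝓑? ≡ (n ∸ ∣ Y ∣) C k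
  card-Layer-avoiding 𝓑? Y (to , from) = begin
    card 𝓑?
      ≡⟨ card-≐ 𝓑? (Interval? (∣ ⊥ {n} ∣ + k) ⊥ (∁ Y))
         ( (λ 𝓑S → let c , S⊆ = to 𝓑S in trans c (cong (_+ k) (sym (∣⊥∣≡0 n))) , ⊥⊆ , S⊆)
         , (λ { (c , _ , S⊆) → from (trans c (cong (_+ k) (∣⊥∣≡0 n)) , S⊆) })) ⟩
    card (Interval? (∣ ⊥ {n} ∣ + k) ⊥ (∁ Y))
      ≡⟨ card-Interval ⊥ (∁ Y) k ⊥⊆ ⟩
    (∣ ∁ Y ∣ ∸ ∣ ⊥ {n} ∣) C k
      ≡⟨ cong (_C k) (cong₂ _∸_ (∣∁p∣≡n∸∣p∣ Y) (∣⊥∣≡0 n)) ⟩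
    (n ∸ ∣ Y ∣) C k ∎
    where open ≡-Reasoning

  card-Layer : card (Layer? {n} k) ≡ n C k
  card-Layer = trans
    (card-Layer-avoiding (Layer? k) ⊥
      ((λ c → c , λ _ → x∉p⇒x∈∁p ∉⊥) , proj₁))
    (cong (λ x → (n ∸ x) C k) (∣⊥∣≡0 n))

  card-Layer-Meets : ∀ Y → n C k ≡ card (Layer? k ∩? Meets? Y) + (n ∸ ∣ Y ∣) C k
  card-Layer-Meets Y = begin
    n C k ≡⟨ card-Layer ⟨
    card (Layer? {n} k) ≡⟨ card-split (Layer? k) (Meets? Y) ⟩
    _ ≡⟨ cong (λ x → card (Layer? k ∩? Meets? Y) + x) (card-Layer-avoiding _ Y
      ( (λ { (c , miss) → c , Empty-∩⇒⊆∁ miss }) , (λ { (c , S⊆∁Y) → c , ⊆∁⇒Empty-∩ S⊆∁Y }))) ⟩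
    card (Layer? k ∩? Meets? Y) + (n ∸ ∣ Y ∣) C k ∎
    where open ≡-Reasoning

  -- Inclusion-exclusion: sets avoiding `Y` split into `onlyZ` and `neither`, sets meeting `Z` into
  -- `both` and `onlyZ`, so both sides count `both`, `onlyZ` and `neither` once each.
  card-Layer-Meets₂ : ∀ Y Z →
    card ((Layer? k ∩? Meets? Y) ∩? Meets? Z) + (n ∸ ∣ Y ∣) C k ≡
    card (Layer? k ∩? Meets? Z) + (n ∸ ∣ Y ∪ Z ∣) C k
  card-Layer-Meets₂ Y Z = +-cancelˡ-≡ onlyZ _ _ (begin
    onlyZ + (both + (n ∸ ∣ Y ∣) C k)      ≡⟨ cong (λ x → onlyZ + (both + x)) avoidY ⟨
    onlyZ + (both + (onlyZ + neither))    ≡⟨ rearrange onlyZ both neither ⟩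
    onlyZ + ((both + onlyZ) + neither)    ≡⟨ cong₂ (λ x w → onlyZ + (x + w)) (sym meetsZ) avoidYZ ⟩
    onlyZ + (card (Layer? k ∩? Meets? Z) + (n ∸ ∣ Y ∪ Z ∣) C k) ∎)
    where
    open ≡-Reasoning
    Avoids? = Layer? k ∩? ∁? (Meets? Y)
    both    = card ((Layer? k ∩? Meets? Y) ∩? Meets? Z)
    onlyZ   = card (Avoids? ∩? Meets? Z)
    neither = card (Avoids? ∩? ∁? (Meets? Z))
    rearrange : ∀ a b c → a + (b + (a + c)) ≡ a + ((b + a) + c)
    rearrange = solve-∀
    avoidY : onlyZ + neither ≡ (n ∸ ∣ Y ∣) C k
    avoidY = trans (sym (card-split Avoids? (Meets? Z))) (card-Layer-avoiding Avoids? Y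
      ( (λ { (c , miss) → c , Empty-∩⇒⊆∁ miss }) , (λ { (c , S⊆∁Y) → c , ⊆∁⇒Empty-∩ S⊆∁Y })))
    meetsZ : card (Layer? k ∩? Meets? Z) ≡ both + onlyZ
    meetsZ = trans (card-split (Layer? k ∩? Meets? Z) (Meets? Y)) (cong₂ _+_
      (card-∩-swap (Layer? k) (Meets? Z) (Meets? Y))
      (card-∩-swap (Layer? k) (Meets? Z) (∁? (Meets? Y))))
    avoidYZ : neither ≡ (n ∸ ∣ Y ∪ Z ∣) C k
    avoidYZ = card-Layer-avoiding (Avoids? ∩? ∁? (Meets? Z)) (Y ∪ Z)
      ( (λ ((c , missY) , missZ) → c , λ x∈S → x∉p⇒x∈∁p λ x∈Y∪Z →
          [ (λ x∈Y → missY (_ , x∈p∩q⁺ (x∈S , x∈Y)))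
          , (λ x∈Z → missZ (_ , x∈p∩q⁺ (x∈S , x∈Z))) ]′ (x∈p∪q⁻ Y Z x∈Y∪Z))
      , (λ (c , S⊆∁) →
          (c , ⊆∁⇒Empty-∩ (⊆-trans S⊆∁ (p⊆q⇒∁p⊇∁q (p⊆p∪q Z))))
             , ⊆∁⇒Empty-∩ (⊆-trans S⊆∁ (p⊆q⇒∁p⊇∁q (q⊆p∪q Y Z)))))

Above : ∀ {n} → ℕ → Subset n → Family n
Above k P S = ∣ S ∣ ≡ k × P ⊆ S

Above? : ∀ {n} k (P : Subset n) → Decidable (Above k P)
Above? k P S = (∣ S ∣ ≟ k) ×-dec (P ⊆? S)

module _ {n : ℕ} (P : Subset n) {k : ℕ} (j : ℕ) (∣P∣+j≡k : ∣ P ∣ + j ≡ k) where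

  private
    card-Interval′ : ∀ R → P ⊆ R → card (Interval? k P R) ≡ (∣ R ∣ ∸ ∣ P ∣) C j
    card-Interval′ R P⊆R = subst (λ k → card (Interval? k P R) ≡ _) ∣P∣+j≡k (card-Interval P R j P⊆R)

  card-Above : card (Above? k P) ≡ (n ∸ ∣ P ∣) C j
  card-Above = trans (card-≐ _ (Interval? k P ⊤)
    ((λ { (c , P⊆S) → c , P⊆S , ⊆⊤ }) , (λ { (c , P⊆S , _) → c , P⊆S })))
    (trans (card-Interval′ ⊤ ⊆⊤) (cong (λ x → (x ∸ ∣ P ∣) C j) (∣⊤∣≡n n)))

  card-Above-Meets : ∀ Y → Nonempty (P ∩ Y) → card (Above? k P ∩? Meets? Y) ≡ (n ∸ ∣ P ∣) C j
  card-Above-Meets Y (x , x∈P∩Y) = trans (card-≐ _ (Above? k P)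
    ( proj₁
    , (λ { (c , P⊆S) → let x∈P , x∈Y = x∈p∩q⁻ P Y x∈P∩Y in
           (c , P⊆S) , x , x∈p∩q⁺ (P⊆S x∈P , x∈Y) })))
    card-Above

  -- The sets above `P` that miss `Y` form the interval from `P` to the complement of `Y`, which
  -- contains `P` by disjointness.
  card-Above-Meets-disjoint : ∀ Y → Empty (P ∩ Y) →
    card (Above? k P ∩? Meets? Y) + (n ∸ ∣ Y ∣ ∸ ∣ P ∣) C j ≡ (n ∸ ∣ P ∣) C j
  card-Above-Meets-disjoint Y P∩Y=∅ = trans (cong (λ x → card (Above? k P ∩? Meets? Y) + x) (sym avoids))
    (trans (sym (card-split (Above? k P) (Meets? Y))) card-Above)
    where
    avoids : card (Above? k P ∩? ∁? (Meets? Y)) ≡ (n ∸ ∣ Y ∣ ∸ ∣ P ∣) C j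
    avoids = trans (card-≐ _ (Interval? k P (∁ Y))
      ( (λ { ((c , P⊆S) , miss) → c , P⊆S , Empty-∩⇒⊆∁ miss })
      , (λ { (c , P⊆S , S⊆∁Y) → (c , P⊆S) , ⊆∁⇒Empty-∩ S⊆∁Y })))
      (trans (card-Interval′ (∁ Y) (Empty-∩⇒⊆∁ P∩Y=∅)) (cong (λ x → (x ∸ ∣ P ∣) C j) (∣∁p∣≡n∸∣p∣ Y)))

∣p∪q∣+∣p∩q∣≡∣p∣+∣q∣ : ∀ {n} (p q : Subset n) → ∣ p ∪ q ∣ + ∣ p ∩ q ∣ ≡ ∣ p ∣ + ∣ q ∣
∣p∪q∣+∣p∩q∣≡∣p∣+∣q∣ [] [] = refl
∣p∪q∣+∣p∩q∣≡∣p∣+∣q∣ (true ∷ p) (true ∷ q) = cong suc (trans (+-suc _ _)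
  (trans (cong suc (∣p∪q∣+∣p∩q∣≡∣p∣+∣q∣ p q)) (sym (+-suc _ _))))
∣p∪q∣+∣p∩q∣≡∣p∣+∣q∣ (true ∷ p) (false ∷ q) = cong suc (∣p∪q∣+∣p∩q∣≡∣p∣+∣q∣ p q)
∣p∪q∣+∣p∩q∣≡∣p∣+∣q∣ (false ∷ p) (true ∷ q) =
  trans (cong suc (∣p∪q∣+∣p∩q∣≡∣p∣+∣q∣ p q)) (sym (+-suc _ _))
∣p∪q∣+∣p∩q∣≡∣p∣+∣q∣ (false ∷ p) (false ∷ q) = ∣p∪q∣+∣p∩q∣≡∣p∣+∣q∣ p q

-- Written with `<ᵇ` so that `[ 2 ⋯ suc m ]` and `[ 1 ⋯ suc m ]` reduce to `initial m` behind a head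
-- of `false` and `true` respectively.
initial : ∀ {n} → ℕ → Subset n
initial m = tabulate λ i → toℕ i <ᵇ m

∣initial∣ : ∀ {n m} → m ≤ n → ∣ initial {n} m ∣ ≡ m
∣initial∣ {zero}  z≤n       = refl
∣initial∣ {suc n} z≤n       = ∣initial∣ {n} z≤n
∣initial∣ {suc n} (s≤s m≤n) = cong suc (∣initial∣ m≤n)

Prefix-≥-suc⁺ : ∀ {xs ys} → Prefix _≥_ xs ys → Prefix _≥_ (List.map suc xs) (List.map suc ys)
Prefix-≥-suc⁺ = map⁺ suc suc ∘ Prefix.map s≤s

Prefix-≥-suc⁻ : ∀ {xs ys} → Prefix _≥_ (List.map suc xs) (List.map suc ys) → Prefix _≥_ xs ys
Prefix-≥-suc⁻ = Prefix.map s≤s⁻¹ ∘ map⁻ suc suc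

-- Initial segments and the order ≼

Nonempty-outside⁺ : ∀ {n} {p : Subset n} → Nonempty p → Nonempty (false ∷ p)
Nonempty-outside⁺ (x , x∈p) = suc x , there x∈p

Nonempty-outside⁻ : ∀ {n} {p : Subset n} → Nonempty (false ∷ p) → Nonempty p
Nonempty-outside⁻ (suc x , there x∈p) = x , x∈p

elements-positive : ∀ {n} (S : Subset n) → 0 ∉ elements S
elements-positive (true ∷ S)  (Any.there 0∈) with _ , _ , () ← ∈-map⁻ suc 0∈
elements-positive (false ∷ S) 0∈ with _ , _ , () ← ∈-map⁻ suc 0∈

-- A set without 1 has all elements at least 2, so its least element cannot be bounded by 1.
¬Prefix-1∷-suc : ∀ {n xs} (S : Subset n) → ¬ Prefix _≥_ (1 ∷ xs) (List.map suc (elements S))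
¬Prefix-1∷-suc S p with elements S | elements-positive S
¬Prefix-1∷-suc S ()          | []        | _
¬Prefix-1∷-suc S (_ ∷ _)     | zero ∷ _  | 0∉ = 0∉ (Any.here refl)
¬Prefix-1∷-suc S (s≤s () ∷ _) | suc _ ∷ _ | _

initial-0 : ∀ n → initial {n} 0 ≡ ⊥
initial-0 zero    = refl
initial-0 (suc n) = cong (false ∷_) (initial-0 n)

elements-⊥ : ∀ n → elements (⊥ {n}) ≡ []
elements-⊥ zero    = refl
elements-⊥ (suc n) = cong (List.map suc) (elements-⊥ n)

-- Needed because the tail of `single 1` marks the shifted value 0, which no position represents.
single-0 : ∀ n → single {n} 0 ≡ ⊥
single-0 zero    = refl
single-0 (suc n) = cong (false ∷_) (single-0 n)

elements-single : ∀ {n x} → x < n → elements (single {n} (suc x)) ≡ suc x ∷ []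
elements-single {suc n} {zero} _ =
  cong (λ S → 1 ∷ List.map suc S) (trans (cong elements (single-0 n)) (elements-⊥ n))
elements-single {suc n} {suc x} (s≤s x<n) = cong (List.map suc) (elements-single x<n)

-- The i-th smallest element is always at least i, so the bounds 1, 2, 3, ... can only be attained
-- with equality.
initial-≼ : ∀ {n} m (S : Subset n) → (S ≼ initial m) ⇔ (initial m ⊆ S)
initial-≼ {n} m S = mk⇔ (to m S) (from m S)
  where
  to : ∀ {n} m (S : Subset n) → S ≼ initial m → initial m ⊆ S
  to {n} zero S _ = subst (_⊆ S) (sym (initial-0 n)) ⊥⊆
  to (suc m) (true ∷ S) (_ ∷ p) = s⊆s (to m S (Prefix-≥-suc⁻ p))
  to (suc m) (false ∷ S) p = contradiction p (¬Prefix-1∷-suc S)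
  to (suc m) [] _ = λ ()
  from : ∀ {n} m (S : Subset n) → initial m ⊆ S → S ≼ initial m
  from {n} zero S _ = subst (λ xs → Prefix _≥_ xs (elements S))
    (sym (trans (cong elements (initial-0 n)) (elements-⊥ n))) []
  from (suc m) [] _ = []
  from (suc m) (true ∷ S) i⊆S = s≤s z≤n ∷ Prefix-≥-suc⁺ (from m S (drop-∷-⊆ i⊆S))
  from (suc m) (false ∷ S) i⊆S = contradiction (i⊆S here) λ ()

-- A one-term bound constrains only the least element, and a set meets an initial segment exactly
-- when its least element lies there.
initial-Meets : ∀ {n} c (S : Subset n) → Prefix _≥_ (c ∷ []) (elements S) ⇔ Meets (initial c) S
initial-Meets c S = mk⇔ (to c S) (from c S)
  where
  to : ∀ {n} c (S : Subset n) → Prefix _≥_ (c ∷ []) (elements S) → Meets (initial c) S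
  to (suc c) (true ∷ S) _ = zero , here
  to (suc c) (false ∷ S) p with x , x∈ ← to c S (Prefix-≥-suc⁻ p) = suc x , there x∈
  to zero S p with elements S | elements-positive S
  to zero S (z≤n ∷ []) | zero ∷ _ | 0∉ = contradiction (Any.here refl) 0∉
  from : ∀ {n} c (S : Subset n) → Meets (initial c) S → Prefix _≥_ (c ∷ []) (elements S)
  from {n} zero S (x , x∈) = contradiction
    (subst (x ∈ˢ_) (initial-0 n) (proj₂ (x∈p∩q⁻ S (initial 0) x∈))) ∉⊥
  from (suc c) (true ∷ S) _ = s≤s z≤n ∷ []
  from (suc c) (false ∷ S) (suc x , there x∈) = Prefix-≥-suc⁺ (from c S (x , x∈))

elements-pair : ∀ {N m} → 1 ≤ m → m ≤ N →
                elements (single {suc N} 1 ∪ single (suc m)) ≡ 1 ∷ suc m ∷ []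
elements-pair {N} {suc m} _ m≤N = begin
  1 ∷ List.map suc (elements (single {N} 0 ∪ single (suc m)))
    ≡⟨ cong (λ S → 1 ∷ List.map suc (elements (S ∪ single (suc m)))) (single-0 N) ⟩
  1 ∷ List.map suc (elements (⊥ ∪ single {N} (suc m)))
    ≡⟨ cong (λ S → 1 ∷ List.map suc (elements S)) (∪-identityˡ (single {N} (suc m))) ⟩
  1 ∷ List.map suc (elements (single {N} (suc m)))
    ≡⟨ cong (λ xs → 1 ∷ List.map suc xs) (elements-single m≤N) ⟩
  1 ∷ suc (suc m) ∷ [] ∎
  where open ≡-Reasoning

-- Counting 𝒜(X) and 𝒮(X)

-- Deleting the element 1 and shifting turns [2,b] into initial m with m = b - 1.
module _ {N m κ : ℕ} (2≤m : 2 ≤ m) (m≤N : m ≤ N) where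

  private
    k b : ℕ
    k = suc κ
    b = suc m
    𝒜 : Family (suc N)
    𝒜 = 𝓕₁ k [ 2 ⋯ b ] ∪ᶠ 𝓕₁ k (single 1 ∪ single b)

    elements-1b : elements (single {suc N} 1 ∪ single b) ≡ 1 ∷ b ∷ []
    elements-1b = elements-pair (<⇒≤ 2≤m) m≤N

  𝒜-with-1 : ∀ S → 𝒜 (true ∷ S) ⇔ (Layer κ ∩ᶠ Meets (initial m)) S
  𝒜-with-1 S = mk⇔ to from
    where
    -- A member of F([2,b]) containing 1 has second element at most 3, and b ≥ 3, so it already lies
    -- in F({1,b}). After the shift the bounds read 2 and m.
    second-bounded : (true ∷ S) ≼ [ 2 ⋯ b ] → Prefix _≥_ (m ∷ []) (elements S)
    second-bounded p = go {S = S} 2≤m m≤N p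
      where
      go : ∀ {m N} {S : Subset N} → 2 ≤ m → m ≤ N →
           Prefix _≥_ (List.map suc (elements (initial {N} m))) (1 ∷ List.map suc (elements S)) →
           Prefix _≥_ (m ∷ []) (elements S)
      go {S = S} (s≤s (s≤s _)) (s≤s (s≤s _)) (_ ∷ p) with elements S | p
      ... | _ ∷ _ | s≤s y≤2 ∷ _ = ≤-trans y≤2 (s≤s (s≤s z≤n)) ∷ []
    to : 𝒜 (true ∷ S) → (Layer κ ∩ᶠ Meets (initial m)) S
    to (inj₁ (c , _ , refl , p)) = suc-injective c , Equivalence.to (initial-Meets m S) (second-bounded p)
    to (inj₂ (c , _ , refl , p))
      with _ ∷ p ← subst (λ xs → Prefix _≥_ xs (elements (true ∷ S))) elements-1b p =
      suc-injective c , Equivalence.to (initial-Meets m S) (Prefix-≥-suc⁻ p)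
    from : (Layer κ ∩ᶠ Meets (initial m)) S → 𝒜 (true ∷ S)
    from (c , meets) = inj₂ (cong suc c , _ , refl ,
      subst (λ xs → Prefix _≥_ xs (elements (true ∷ S))) (sym elements-1b)
        (s≤s z≤n ∷ Prefix-≥-suc⁺ (Equivalence.from (initial-Meets m S) meets)))

  -- Without 1 the bound by {1,b} fails at its first entry, so only the generator [2,b] remains.
  𝒜-without-1 : ∀ S → 𝒜 (false ∷ S) ⇔ Above k (initial m) S
  𝒜-without-1 S = mk⇔ to from
    where
    to : 𝒜 (false ∷ S) → Above k (initial m) S
    to (inj₁ (c , _ , refl , p)) = c , Equivalence.to (initial-≼ m S) (Prefix-≥-suc⁻ p)
    to (inj₂ (c , _ , refl , p)) = contradiction
      (subst (λ xs → Prefix _≥_ xs (elements (false ∷ S))) elements-1b p) (¬Prefix-1∷-suc S)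
    from : Above k (initial m) S → 𝒜 (false ∷ S)
    from (c , i⊆S) = inj₁ (c , _ , refl , Prefix-≥-suc⁺ (Equivalence.from (initial-≼ m S) i⊆S))

  card-𝒜⟨X⟩ : ∀ X →
    card ((𝓕₁? k [ 2 ⋯ b ] ∪ᶠ? 𝓕₁? k (single 1 ∪ single b)) ⟨ false ∷ X ⟩?) ≡
    card ((Layer? κ ∩? Meets? (initial m)) ∩? Meets? X) + card (Above? k (initial m) ∩? Meets? X)
  card-𝒜⟨X⟩ X = trans (card-suc 𝒜X?) (cong₂ _+_
    (card-≐ (𝒜X? ∘ (true ∷_)) _
      ( (λ {S} (a , x) → Equivalence.to (𝒜-with-1 S) a , Nonempty-outside⁻ x)
      , (λ {S} (a , x) → Equivalence.from (𝒜-with-1 S) a , Nonempty-outside⁺ x)))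
    (card-≐ (𝒜X? ∘ (false ∷_)) _
      ( (λ {S} (a , x) → Equivalence.to (𝒜-without-1 S) a , Nonempty-outside⁻ x)
      , (λ {S} (a , x) → Equivalence.from (𝒜-without-1 S) a , Nonempty-outside⁺ x))))
    where
    𝒜X? = (𝓕₁? k [ 2 ⋯ b ] ∪ᶠ? 𝓕₁? k (single 1 ∪ single b)) ⟨ false ∷ X ⟩?

card-Star⟨X⟩ : ∀ {n} κ (X : Subset n) →
  card (Star? (suc κ) ⟨ false ∷ X ⟩?) ≡ card (Layer? κ ∩? Meets? X)
card-Star⟨X⟩ κ X = trans (card-suc 𝒮X?) (trans (cong₂ _+_
  (card-≐ (𝒮X? ∘ (true ∷_)) (Layer? κ ∩? Meets? X)
    ( (λ ((c , _) , x) → suc-injective c , Nonempty-outside⁻ x)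
    , (λ (c , x) → (cong suc c , Any.here refl) , Nonempty-outside⁺ x)))
  (card-∅ (𝒮X? ∘ (false ∷_)) λ {S} ((_ , 1∈) , _) → 1∉ S 1∈))
  (+-identityʳ _))
  where
  𝒮X? = Star? (suc κ) ⟨ false ∷ X ⟩?
  1∉ : ∀ {n} (S : Subset n) → 1 ∉ List.map suc (elements S)
  1∉ S 1∈ with _ , 0∈ , refl ← ∈-map⁻ suc 1∈ = elements-positive S 0∈

-- From counts over the naturals to the signed formulas

ℤ-rearrange₁ : ∀ {t s a β γ δ ε} → t + β ≡ s + ε → a ≡ s + δ →
  + (t + γ) ≡ + a ⊖ + β ⊕ + γ ⊖ + δ ⊕ + ε
ℤ-rearrange₁ {t} {s} {a} {β} {γ} {δ} {ε} t+β≡s+ε refl = begin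
  + t ⊕ + γ                                 ≡⟨ expand (+ t) (+ β) (+ γ) ⟩
  (+ t ⊕ + β) ⊖ + β ⊕ + γ                   ≡⟨ cong (λ x → + x ⊖ + β ⊕ + γ) t+β≡s+ε ⟩
  (+ s ⊕ + ε) ⊖ + β ⊕ + γ                   ≡⟨ permute (+ s) (+ β) (+ γ) (+ δ) (+ ε) ⟩
  (+ s ⊕ + δ) ⊖ + β ⊕ + γ ⊖ + δ ⊕ + ε       ∎
  where
  open ≡-Reasoning
  expand : ∀ t β γ → t ⊕ γ ≡ (t ⊕ β) ⊖ β ⊕ γ
  expand = ℤSolver.solve-∀
  permute : ∀ s β γ δ ε → (s ⊕ ε) ⊖ β ⊕ γ ≡ (s ⊕ δ) ⊖ β ⊕ γ ⊖ δ ⊕ ε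
  permute = ℤSolver.solve-∀

ℤ-rearrange₂ : ∀ {t u s a β γ δ ε ζ} → t + β ≡ s + ε → a ≡ s + δ → u + ζ ≡ γ →
  + (t + u) ≡ + a ⊖ + β ⊕ + γ ⊖ + δ ⊕ + ε ⊖ + ζ
ℤ-rearrange₂ {t} {u} {ζ = ζ} t+β≡s+ε a≡s+δ refl =
  trans (cancel (+ t) (+ u) (+ ζ)) (cong (_⊖ + ζ) (ℤ-rearrange₁ {t} {γ = u + ζ} t+β≡s+ε a≡s+δ))
  where
  cancel : ∀ t u ζ → t ⊕ u ≡ (t ⊕ (u ⊕ ζ)) ⊖ ζ
  cancel = ℤSolver.solve-∀

module Counting {N m κ : ℕ} (3≤m : 3 ≤ m) (m≤k : m ≤ suc κ) (2k≤n : 2 * suc κ ≤ suc N)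
                (X : Subset N) where

  private
    -- `B` is the shifted [2,b], j = k + 1 - b, M = n - b, and `w` counts the elements of [2,n]
    -- outside both [2,b] and X. `∣T∣` and `∣U∣` count the members of 𝒜(X) with and without 1.
    B : Subset N
    B = initial m
    j M d w ∣T∣ ∣U∣ ∣𝒮X∣ : ℕ
    j = κ + 1 ∸ m
    M = N ∸ m
    d = ∣ X ∣
    w = N ∸ ∣ B ∪ X ∣
    ∣T∣ = card ((Layer? κ ∩? Meets? B) ∩? Meets? X)
    ∣U∣ = card (Above? (suc κ) B ∩? Meets? X)
    ∣𝒮X∣ = card (Layer? κ ∩? Meets? X)

    m+j≡k : m + j ≡ suc κ
    m+j≡k = trans (m+[n∸m]≡n (≤-trans m≤k (≤-reflexive (+-comm 1 κ)))) (+-comm κ 1)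

    k≤N : suc κ ≤ N
    k≤N = ≤-trans (s≤s (m≤m+n κ (κ + 0))) (≤-trans (≤-reflexive (sym (+-suc κ (κ + 0)))) (s≤s⁻¹ 2k≤n))

    m≤N : m ≤ N
    m≤N = ≤-trans m≤k k≤N

    ∣B∣≡m : ∣ B ∣ ≡ m
    ∣B∣≡m = ∣initial∣ m≤N

    ∣B∣+j≡k : ∣ B ∣ + j ≡ suc κ
    ∣B∣+j≡k = trans (cong (_+ j) ∣B∣≡m) m+j≡k

    T-count : ∣T∣ + M C κ ≡ ∣𝒮X∣ + w C κ
    T-count = trans (cong (λ x → ∣T∣ + (N ∸ x) C κ) (sym ∣B∣≡m)) (card-Layer-Meets₂ κ B X)

    𝒮-count : N C κ ≡ ∣𝒮X∣ + (suc N ∸ d ∸ 1) C κ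
    𝒮-count = trans (card-Layer-Meets κ X) (cong (λ x → ∣𝒮X∣ + x C κ)
      (sym (trans (∸-+-assoc (suc N) d 1) (cong (suc N ∸_) (+-comm d 1)))))

    U-count : Nonempty (X ∩ B) → ∣U∣ ≡ M C j
    U-count X∩B≠∅ = trans (card-Above-Meets B j ∣B∣+j≡k X (subst Nonempty (∩-comm X B) X∩B≠∅))
                          (cong (λ x → (N ∸ x) C j) ∣B∣≡m)

    ∣B∪X∣+μ≡m+d : ∣ B ∪ X ∣ + ∣ X ∩ B ∣ ≡ m + d
    ∣B∪X∣+μ≡m+d = trans (cong (λ Y → ∣ B ∪ X ∣ + ∣ Y ∣) (∩-comm X B))
      (trans (∣p∪q∣+∣p∩q∣≡∣p∣+∣q∣ B X) (cong (_+ d) ∣B∣≡m))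

  𝒜-card : card ((𝓕₁? (suc κ) [ 2 ⋯ suc m ] ∪ᶠ? 𝓕₁? (suc κ) (single 1 ∪ single (suc m)))
                 ⟨ false ∷ X ⟩?) ≡ ∣T∣ + ∣U∣
  𝒜-card = card-𝒜⟨X⟩ (<⇒≤ 3≤m) m≤N X

  module Meeting (X∩B≠∅ : Nonempty (X ∩ B)) where

    formula : + (∣T∣ + ∣U∣) ≡ + (N C κ) ⊖ + (M C κ) ⊕ + (M C j) ⊖ + ((suc N ∸ d ∸ 1) C κ)
                              ⊕ + ((suc N + ∣ X ∩ B ∣ ∸ (d + suc m)) C κ)
    formula = trans (cong (λ x → + (∣T∣ + x)) (U-count X∩B≠∅))
      (ℤ-rearrange₁ {∣T∣} {∣𝒮X∣} (trans T-count (cong (λ x → ∣𝒮X∣ + x C κ) (sym w-formula))) 𝒮-count)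
      where
      open ≡-Reasoning
      -- Adding the overlap before subtracting makes this exact: the union of `B` and `X` has m + d
      -- elements minus the overlap.
      w-formula : suc N + ∣ X ∩ B ∣ ∸ (d + suc m) ≡ w
      w-formula = begin
        suc N + ∣ X ∩ B ∣ ∸ (d + suc m)               ≡⟨ cong (suc N + ∣ X ∩ B ∣ ∸_) (+-comm d (suc m)) ⟩
        N + ∣ X ∩ B ∣ ∸ (m + d)                       ≡⟨ cong (N + ∣ X ∩ B ∣ ∸_) ∣B∪X∣+μ≡m+d ⟨
        N + ∣ X ∩ B ∣ ∸ (∣ B ∪ X ∣ + ∣ X ∩ B ∣)       ≡⟨ [m+n]∸[o+n]≡m∸o N ∣ X ∩ B ∣ ∣ B ∪ X ∣ ⟩
        w                                             ∎
        where
        [m+n]∸[o+n]≡m∸o : ∀ m n o → m + n ∸ (o + n) ≡ m ∸ o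
        [m+n]∸[o+n]≡m∸o m n o = trans (cong₂ _∸_ (+-comm m n) (+-comm o n)) ([m+n]∸[m+o]≡n∸o n m o)

    -- Now w = M, so `T-count` gives that `∣T∣` equals `∣𝒮X∣`: a set meeting `X` already meets `B`.
    contained : X ⊆ B → ∣T∣ + ∣U∣ ≡ ∣𝒮X∣ + M C j
    contained X⊆B = cong₂ _+_ (+-cancelʳ-≡ (M C κ) _ _ (trans T-count (cong (λ x → ∣𝒮X∣ + (N ∸ x) C κ)
      (trans (cong ∣_∣ B∪X≡B) ∣B∣≡m)))) (U-count X∩B≠∅)
      where
      B∪X≡B : B ∪ X ≡ B
      B∪X≡B = ⊆-antisym (λ x∈B∪X → [ (λ x∈B → x∈B) , X⊆B ]′ (x∈p∪q⁻ B X x∈B∪X)) (p⊆p∪q X)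

    -- After adding C(M,k-1) to both sides, `T-count` reduces the claim to `C-growth-gap-∸`; the
    -- element outside `B` gives w < M.
    strict : (∃ λ x → x ∈ˢ X × ¬ (x ∈ˢ B)) → 4 * suc κ ≤ suc N → ∣T∣ + ∣U∣ < ∣𝒮X∣
    strict (x , x∈X , x∉B) 4k≤n = +-cancelʳ-< (M C κ) _ _ (begin-strict
      ∣T∣ + ∣U∣ + M C κ         ≡⟨ cong (λ x → ∣T∣ + x + M C κ) (U-count X∩B≠∅) ⟩
      ∣T∣ + M C j + M C κ       ≡⟨ swapʳ ∣T∣ (M C j) (M C κ) ⟩
      ∣T∣ + M C κ + M C j       ≡⟨ cong (_+ M C j) T-count ⟩
      ∣𝒮X∣ + w C κ + M C j      ≡⟨ rotate ∣𝒮X∣ (w C κ) (M C j) ⟩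
      ∣𝒮X∣ + (M C j + w C κ)    <⟨ +-monoʳ-< ∣𝒮X∣ (C-growth-gap-∸ 3≤m m+j≡k 4k≤n w<M) ⟩
      ∣𝒮X∣ + M C κ              ∎)
      where
      open ≤-Reasoning
      swapʳ : ∀ a b c → a + b + c ≡ a + c + b
      swapʳ = solve-∀
      rotate : ∀ a b c → a + b + c ≡ a + (c + b)
      rotate = solve-∀
      m<∣B∪X∣ : m < ∣ B ∪ X ∣
      m<∣B∪X∣ = subst (_< ∣ B ∪ X ∣) ∣B∣≡m
        (p⊂q⇒∣p∣<∣q∣ (p⊆p∪q X , x , q⊆p∪q B X x∈X , x∉B))
      w<M : w < M
      w<M = ∸-monoʳ-< m<∣B∪X∣ (∣p∣≤n (B ∪ X))

  module Avoiding (X∩B=∅ : Empty (X ∩ B)) where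

    private
      ∣B∪X∣≡d+m : ∣ B ∪ X ∣ ≡ d + m
      ∣B∪X∣≡d+m = begin
        ∣ B ∪ X ∣                 ≡⟨ +-identityʳ _ ⟨
        ∣ B ∪ X ∣ + 0             ≡⟨ cong (λ x → ∣ B ∪ X ∣ + x) (trans (cong ∣_∣ (Empty-unique X∩B=∅)) (∣⊥∣≡0 N)) ⟨
        ∣ B ∪ X ∣ + ∣ X ∩ B ∣     ≡⟨ ∣B∪X∣+μ≡m+d ⟩
        m + d                     ≡⟨ +-comm m d ⟩
        d + m                     ∎
        where open ≡-Reasoning

      w≡N∸d∸m : w ≡ N ∸ d ∸ m
      w≡N∸d∸m = trans (cong (N ∸_) ∣B∪X∣≡d+m) (sym (∸-+-assoc N d m))

      w-formula : w ≡ suc N ∸ d ∸ suc m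
      w-formula = trans (cong (N ∸_) ∣B∪X∣≡d+m)
        (sym (trans (∸-+-assoc (suc N) d (suc m)) (cong (suc N ∸_) (+-suc d m))))

      U-count′ : ∣U∣ + w C j ≡ M C j
      U-count′ = begin
        ∣U∣ + w C j                     ≡⟨ cong (λ x → ∣U∣ + x C j) w≡N∸d∸m ⟩
        ∣U∣ + (N ∸ d ∸ m) C j           ≡⟨ cong (λ x → ∣U∣ + (N ∸ d ∸ x) C j) ∣B∣≡m ⟨
        ∣U∣ + (N ∸ d ∸ ∣ B ∣) C j       ≡⟨ card-Above-Meets-disjoint B j ∣B∣+j≡k X (subst Empty (∩-comm X B) X∩B=∅) ⟩
        (N ∸ ∣ B ∣) C j                 ≡⟨ cong (λ x → (N ∸ x) C j) ∣B∣≡m ⟩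
        M C j                           ∎
        where open ≡-Reasoning

    formula : + (∣T∣ + ∣U∣) ≡ + (N C κ) ⊖ + (M C κ) ⊕ + (M C j) ⊖ + ((suc N ∸ d ∸ 1) C κ)
                              ⊕ + ((suc N ∸ d ∸ suc m) C κ) ⊖ + ((suc N ∸ d ∸ suc m) C j)
    formula rewrite sym w-formula = ℤ-rearrange₂ {∣T∣} {∣U∣} {∣𝒮X∣} T-count 𝒮-count U-count′

    -- Both counts have a subtracted term at `M` or `w`; moving these over leaves C(x,k-1) - C(x,j)
    -- to be compared at x = w and x = M.
    bound : ∣T∣ + ∣U∣ ≤ ∣𝒮X∣
    bound = +-cancelʳ-≤ (M C κ + w C j) _ _ (begin
      ∣T∣ + ∣U∣ + (M C κ + w C j)     ≡⟨ interchange ∣T∣ ∣U∣ (M C κ) (w C j) ⟩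
      ∣T∣ + M C κ + (∣U∣ + w C j)     ≡⟨ cong₂ _+_ T-count U-count′ ⟩
      ∣𝒮X∣ + w C κ + M C j            ≡⟨ +-assoc ∣𝒮X∣ (w C κ) (M C j) ⟩
      ∣𝒮X∣ + (w C κ + M C j)          ≤⟨ +-monoʳ-≤ ∣𝒮X∣ (C-difference-mono j≤κ j+κ≤M w≤M) ⟩
      ∣𝒮X∣ + (M C κ + w C j)          ∎)
      where
      open ≤-Reasoning
      interchange : ∀ a b c e → a + b + (c + e) ≡ a + c + (b + e)
      interchange = solve-∀
      w≤M : w ≤ M
      w≤M = ∸-monoʳ-≤ N (≤-trans (m≤n+m m d) (≤-reflexive (sym ∣B∪X∣≡d+m)))
      j≤κ : j ≤ κ
      j≤κ = +-cancelˡ-≤ 1 _ _ (≤-trans (+-monoˡ-≤ j (≤-trans (s≤s z≤n) 3≤m)) (≤-reflexive m+j≡k))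
      -- Written out, (k + 1 - b) + (k - 1) ≤ n - b is exactly 2k ≤ n.
      j+κ≤M : j + κ ≤ M
      j+κ≤M = m+n≤o⇒m≤o∸n (j + κ) (s≤s⁻¹ (≤-trans (≤-reflexive (begin-equality
        suc (j + κ + m)         ≡⟨ rearrange j κ m ⟩
        suc κ + (m + j)         ≡⟨ cong (λ x → suc κ + x) m+j≡k ⟩
        suc κ + suc κ           ≡⟨ cong (λ x → suc κ + x) (+-identityʳ (suc κ)) ⟨
        2 * suc κ               ∎)) 2k≤n))
        where
        rearrange : ∀ j κ m → suc (j + κ + m) ≡ suc κ + (m + j)
        rearrange = solve-∀

theorem1p6 :
  ∀ (k : ℕ) → ∃ λ (n₀ : ℕ) →
  ∀ (n b : ℕ) → 4 ≤ 2 * k → 2 * k ≤ n → 4 ≤ b → b ≤ k + 1 →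
  let 𝒜 : Family n
      𝒜 = 𝓕₁ k [ 2 ⋯ b ] ∪ᶠ 𝓕₁ k (single 1 ∪ single b)
      𝒜? : Decidable 𝒜
      𝒜? = 𝓕₁? k [ 2 ⋯ b ] ∪ᶠ? 𝓕₁? k (single 1 ∪ single b)
  in
  MLCIF k 𝒜 →
  ∀ (𝒢 : List (Subset n)) → PGS k 𝒢 → Generates k 𝒢 𝒜 →
  HasRank 𝒢 2 → ExactlyTwo (MaximalGenerator 𝒢) →
  ∀ (X : Subset n) → X ⊆ [ 2 ⋯ n ] → ∀ (d : ℕ) → ∣ X ∣ ≡ d →
  let ∣𝒜X∣ = card (𝒜? ⟨ X ⟩?)
      ∣𝒮X∣ = card (Star? k ⟨ X ⟩?)
      μ = ∣ X ∩ [ 1 ⋯ b ] ∣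
  in
  ( Nonempty (X ∩ [ 2 ⋯ b ]) →
      ( + ∣𝒜X∣ ≡ + ((n ∸ 1) C (k ∸ 1)) ⊖ + ((n ∸ b) C (k ∸ 1))
                 ⊕ + ((n ∸ b) C (k + 1 ∸ b)) ⊖ + ((n ∸ d ∸ 1) C (k ∸ 1))
                 ⊕ + ((n + μ ∸ (d + b)) C (k ∸ 1)) )
    × ( X ⊆ [ 2 ⋯ b ] → ∣𝒜X∣ ≡ ∣𝒮X∣ + (n ∸ b) C (k + 1 ∸ b) )
    × ( (X ∩ [ 2 ⋯ b ]) ⊂ X → n₀ ≤ n → ∣𝒜X∣ < ∣𝒮X∣ ) )
  ×
  ( Empty (X ∩ [ 2 ⋯ b ]) →
      ( + ∣𝒜X∣ ≡ + ((n ∸ 1) C (k ∸ 1)) ⊖ + ((n ∸ b) C (k ∸ 1))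
                 ⊕ + ((n ∸ b) C (k + 1 ∸ b)) ⊖ + ((n ∸ d ∸ 1) C (k ∸ 1))
                 ⊕ + ((n ∸ d ∸ b) C (k ∸ 1)) ⊖ + ((n ∸ d ∸ b) C (k + 1 ∸ b)) )
    × ∣𝒜X∣ ≤ ∣𝒮X∣ )
-- The threshold 0 is a default, since k = 0 contradicts 4 ≤ 2k.
theorem1p6 zero = 0 , λ _ _ ()
-- The threshold 4k is the one that `C-growth-gap-∸` requires.
theorem1p6 (suc κ) = 4 * suc κ , λ where
  zero _ _ ()
  (suc N) zero _ _ ()
  (suc N) (suc m) _ _ _ _ _ _ _ _ _ _ (true ∷ X) X⊆[2⋯n] → contradiction (X⊆[2⋯n] here) λ ()
  (suc N) (suc m) _ 2k≤n (s≤s 3≤m) b≤k+1 _ _ _ _ _ _ (false ∷ X) _ _ refl →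
    let m≤k = ≤-trans (s≤s⁻¹ b≤k+1) (≤-reflexive (+-comm κ 1))
        open Counting 3≤m m≤k 2k≤n X
    in
    ( λ X∩[2⋯b]≠∅ →
        let open Meeting (Nonempty-outside⁻ X∩[2⋯b]≠∅) in
        trans (cong +_ 𝒜-card) formula
      , (λ X⊆[2⋯b] → trans 𝒜-card
          (trans (contained (drop-∷-⊆ X⊆[2⋯b])) (cong (_+ _) (sym (card-Star⟨X⟩ κ X)))))
      -- Properness of the inclusion supplies an element of X outside [2,b]; it is not 1, as the
      -- head of the set is `false`.
      , λ { (_ , suc x , there x∈X , x∉) n₀≤n →
          subst₂ _<_ (sym 𝒜-card) (sym (card-Star⟨X⟩ κ X))
            (strict (x , x∈X , λ x∈B → x∉ (there (x∈p∩q⁺ (x∈X , x∈B)))) n₀≤n) } )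
    , λ X∩[2⋯b]=∅ →
        let open Avoiding (drop-∷-Empty X∩[2⋯b]=∅) in
        trans (cong +_ 𝒜-card) formula
      , subst₂ _≤_ (sym 𝒜-card) (sym (card-Star⟨X⟩ κ X)) bound
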